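{- Let $\vec U$ be a universe of separations and $\vec S\subseteq\vec U$ a submodular separation system. Let $\mathcal F\subseteq 2^{\vec U}$ be a set of stars which is standard for $\vec S$ and closed under shifting (in $\vec S$). Then exactly one of the following holds: (i) There exists an $\mathcal F$-tangle of $S$. (ii) There exists an $S$-tree over $\mathcal F$.
   Context: A separation system $(\vec S,\le,{}^*)$ is a partially ordered set with an order-reversing involution $^*:\vec S\to\vec S$. Its elements are called oriented separations. An (unoriented) separation is a set $s=\{\vec s,\vec s^{\,*}\}$; $S$ denotes the set of all these. $\vec s$ is degenerate if $\vec s=\vec s^{\,*}$. A universe of separations is a separation system $\vec U$ whose partial order is a lattice (join $\vee$, meet $\wedge$). A separation system $\vec S\subseteq\vec U$ is a subset closed under $^*$, with the induced order and involution. It is submodular if for all $\vec s,\vec t\in\vec S$ at least one of $\vec s\vee\vec t$, $\vec s\wedge\vec t$ (computed in $\vec U$) lies in $\vec S$. $\vec s\in\vec S$ is trivial in $\vec S$ if there is $t\in S$ whose orientations satisfy $\vec s<\vec t$ and $\vec s<\vec t^{\,*}$. A star is a set $\sigma$ of non-degenerate oriented separations such that $\vec s\le\vec t^{\,*}$ for any two distinct $\vec s,\vec t\in\sigma$. $\mathcal F$ is standard for $\vec S$ if $\{\vec s^{\,*}\}\in\mathcal F$ for every $\vec s\in\vec S$ trivial in $\vec S$. $\vec s\in\vec S$ emulates $\vec r$ in $\vec S$ if $\vec s\ge\vec r$ and for every $\vec t\in\vec S\setminus\{\vec r^{\,*}\}$ with $\vec t\ge\vec r$ we have $\vec s\vee\vec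 t\in\vec S$. For $\vec s\in\vec S$, $\sigma\subseteq\vec S$ and $\vec x\in\sigma$ let $\sigma_{\vec x}^{\vec s}:=\{\vec x\vee\vec s\}\cup\{\vec y\wedge\vec s^{\,*}:\vec y\in\sigma\setminus\{\vec x\}\}$. $\vec s$ emulates $\vec r$ in $\vec S$ for $\mathcal F$ if $\vec s$ emulates $\vec r$ in $\vec S$ and for every star $\sigma\subseteq\vec S\setminus\{\vec r^{\,*}\}$ with $\sigma\in\mathcal F$ and every $\vec x\in\sigma$ with $\vec x\ge\vec r$ we have $\sigma_{\vec x}^{\vec s}\in\mathcal F$. $\mathcal F$ is closed under shifting (in $\vec S$) if whenever $\vec s\in\vec S$ emulates in $\vec S$ some non-trivial (in $\vec S$) and non-degenerate $\vec r\in\vec S$ with $\{\vec r^{\,*}\}\notin\mathcal F$, then it emulates $\vec r$ in $\vec S$ for $\mathcal F$. An orientation of $S$ is a set $O\subseteq\vec S$ containing exactly one of $\vec s,\vec s^{\,*}$ for every $s\in S$ (the single element, if $s$ is degenerate). It is consistent if whenever $r,s\in S$ are distinct with orientations $\vec r\le\vec s\in O$, then $\vec r^{\,*}\notin O$. An $\mathcal F$-tangle of $S$ is a consistent orientation $O$ of $S$ such that no subset of $O$ is an element of $\mathcal F$. An $S$-tree is a pair $(T,\alpha)$ of a tree $T$ and a map $\alpha$ from the set $\vec E(T)=\{(x,y): xy\in E(T)\}$ of orientations of edges of $T$ to $\vec S$ such that $\alpha(y,x)=\alpha(x,y)^*$ for all $xy\in E(T)$. It is an $S$-tree over $\mathcal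 F$ if $\alpha(F_t)\in\mathcal F$ for every node $t$ of $T$, where $F_t=\{(s,t): st\in E(T)\}$.
   Formalization: The separation system S is assumed finite, and the tree T of an S-tree is required to be finite; without these assumptions the statement fails (both alternatives, or neither, can hold). -}

module Defs where

open import Algebra.Core using (Op₁; Op₂)
open import Algebra.Definitions using (Involutive)
open import Data.List.Base using (List; _∷_; _∷ʳ_; length)
import Data.List.Membership.Propositional as List
open import Data.List.Relation.Unary.Linked using (Linked)
open import Data.List.Relation.Unary.Unique.Propositional using (Unique)
open import Data.Nat.Base using () renaming (_≤_ to _≤ⁿ_)
open import Data.Product.Base using (Σ-syntax; ∃-syntax; _×_)
open import Data.Sum.Base using (_⊎_)
open import Level using (Level; 0ℓ; _⊔_) renaming (suc to lsuc)
open import Relation.Binary.Construct.Closure.ReflexiveTransitive using (Star)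
import Relation.Binary.Construct.NonStrictToStrict as NonStrictToStrict
open import Relation.Binary.Core using (Rel)
open import Relation.Binary.Definitions using (Antitonic₁; Irreflexive; Symmetric)
open import Relation.Binary.Lattice.Structures using (IsLattice)
open import Relation.Binary.PropositionalEquality.Core using (_≡_; _≢_)
open import Relation.Nullary.Negation.Core using (¬_)
open import Relation.Unary using (Pred; _∈_; _∉_; _⊆_; _∪_; _∖_; ｛_｝)

private
  variable
    a p q : Level

ExactlyOneOf : Set p → Set q → Set (p ⊔ q)
ExactlyOneOf P Q = (P ⊎ Q) × ¬ (P × Q)

IsFinite : {A : Set a} → Pred A p → Set (a ⊔ p)
IsFinite {A = A} P = Σ[ xs ∈ List A ] (∀ {x} → x ∈ P → x List.∈ xs)

record FiniteGraph : Set₁ where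
  field
    V           : Set
    E           : Rel V 0ℓ
    symmetric   : Symmetric E
    irreflexive : Irreflexive _≡_ E
    vertices    : List V
    enumerates  : ∀ v → v List.∈ vertices

  record IsCycle (v : V) (vs : List V) : Set where
    field
      long   : 3 ≤ⁿ length (v ∷ vs)
      simple : Unique (v ∷ vs)
      closed : Linked E (v ∷ vs ∷ʳ v)

  record IsTree : Set where
    field
      node      : V
      connected : ∀ x y → Star E x y
      acyclic   : ∀ v vs → ¬ IsCycle v vs

record Universe (c ℓ : Level) : Set (lsuc (c ⊔ ℓ)) where
  infix  4 _≤_
  infixr 6 _∨_
  infixr 7 _∧_
  infixl 8 _*
  field
    Carrier      : Set c
    _≤_          : Rel Carrier ℓ
    _∨_          : Op₂ Carrier
    _∧_          : Op₂ Carrier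
    _*           : Op₁ Carrier
    isLattice    : IsLattice _≡_ _≤_ _∨_ _∧_
    *-involutive : Involutive _≡_ _*
    *-antitone   : Antitonic₁ _≤_ _≤_ _*

  open IsLattice isLattice public
  open NonStrictToStrict _≡_ _≤_ public using (_<_)

module Separations {c ℓ : Level} (U : Universe c ℓ) where

  open Universe U

  Subset : Set (lsuc c)
  Subset = Pred Carrier c

  -- Subsets are predicates, hence not extensional: a family represents a
  -- set of subsets of the universe only if it also respects _≐_.
  Family : (f : Level) → Set (lsuc c ⊔ lsuc f)
  Family f = Pred Subset f

  Degenerate : Carrier → Set c
  Degenerate s = s ≡ s *

  -- r and s are orientations of the same unoriented separation.
  SameSeparation : Rel Carrier c
  SameSeparation r s = r ≡ s ⊎ r ≡ s *

  IsSeparationSystem : Subset → Set c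
  IsSeparationSystem S = ∀ {s} → s ∈ S → s * ∈ S

  Submodular : Subset → Set c
  Submodular S = ∀ {s t} → s ∈ S → t ∈ S → s ∨ t ∈ S ⊎ s ∧ t ∈ S

  IsStar : Subset → Set (c ⊔ ℓ)
  IsStar σ = (∀ {s} → s ∈ σ → ¬ Degenerate s)
           × (∀ {s t} → s ∈ σ → t ∈ σ → s ≢ t → s ≤ t *)

  -- σ with x shifted to x ∨ s and every other y shifted to y ∧ s *.
  shift : Subset → Carrier → Carrier → Subset
  shift σ x s = ｛ x ∨ s ｝ ∪ λ z → ∃[ y ] y ∈ σ × y ≢ x × z ≡ y ∧ s *

  module _ (S : Subset) where

    TrivialIn : Carrier → Set (c ⊔ ℓ)
    TrivialIn s = s ∈ S × ∃[ t ] t ∈ S × s < t × s < t *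

    Emulates : Carrier → Carrier → Set (c ⊔ ℓ)
    Emulates s r = s ∈ S × r ≤ s
                 × (∀ {t} → t ∈ S → t ≢ r * → r ≤ t → s ∨ t ∈ S)

    IsOrientation : Subset → Set c
    IsOrientation O = O ⊆ S
                    × (∀ {s} → s ∈ S → s ∈ O ⊎ s * ∈ O)
                    × (∀ {s} → s ∈ O → s * ∈ O → Degenerate s)

    Consistent : Subset → Set (c ⊔ ℓ)
    Consistent O = ∀ {r s} → r ∈ S → s ∈ S → ¬ SameSeparation r s →
                   r ≤ s → s ∈ O → r * ∉ O

    record STree : Set (lsuc 0ℓ ⊔ c) where
      field
        T      : FiniteGraph
      open FiniteGraph T public
      field
        isTree : IsTree
        α      : ∀ {x y} → E x y → Carrier
        α∈S    : ∀ {x y} (e : E x y) → α e ∈ S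
        -- Ranging over all proofs e and e′ of adjacency, this also makes
        -- α depend only on the ordered pair of end nodes.
        α-*    : ∀ {x y} (e : E x y) (e′ : E y x) → α e′ ≡ α e *

      -- The image under α of the set of edges oriented towards t.
      αF : V → Subset
      αF t z = ∃[ s ] Σ[ e ∈ E s t ] z ≡ α e

    module _ {f : Level} (F : Family f) where

      Standard : Set (c ⊔ ℓ ⊔ f)
      Standard = ∀ {s} → TrivialIn s → ｛ s * ｝ ∈ F

      EmulatesFor : Carrier → Carrier → Set (lsuc c ⊔ ℓ ⊔ f)
      EmulatesFor s r = Emulates s r
                      × (∀ {σ x} → IsStar σ → σ ⊆ S ∖ ｛ r * ｝ → σ ∈ F →
                         x ∈ σ → r ≤ x → shift σ x s ∈ F)

      ClosedUnderShifting : Set (lsuc c ⊔ ℓ ⊔ f)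
      ClosedUnderShifting =
        ∀ {s r} → s ∈ S → r ∈ S → ¬ TrivialIn r → ¬ Degenerate r →
        ｛ r * ｝ ∉ F → Emulates s r → EmulatesFor s r

      IsTangle : Subset → Set (lsuc c ⊔ ℓ ⊔ f)
      IsTangle O = IsOrientation O × Consistent O × (∀ {τ} → τ ⊆ O → τ ∉ F)

      STreeOver : Set (lsuc 0ℓ ⊔ c ⊔ f)
      STreeOver = Σ[ T ∈ STree ] ∀ t → STree.αF T t ∈ F

-- Unit propagation. For P ⊆ S, close P under the rule: if σ ∈ F and all of σ
-- except x is forced, then x * is forced. A derivation without axioms is a rooted
-- S-tree over F, so an S-tree over F exists once some σ ∈ F is forced from ∅
-- ("P is in conflict" for P = ∅). If there is no F-tangle, every consistent
-- orientation P of S is in conflict, and this is propagated down to ∅: if P is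
-- down-closed and r is undecided, take undecided r₁ ≤ r and r₂ ≤ r * that are
-- minimal. If P ∪ {r₁} and P ∪ {r₂} are in conflict and P is not, then r₁ * and
-- r₂ * are forced by P. By submodularity some s between r₁ and r₂ * emulates r₁
-- while s * emulates r₂, and shifting the two derivations turns them into
-- derivations of s * and s, which together are a conflict for P.
module Submission where

open import Defs
open import Axiom.ExcludedMiddle using (ExcludedMiddle)
open import Data.Bool.Base using (Bool; true; false)
open import Data.Empty using (⊥; ⊥-elim)
import Data.Empty.Polymorphic as Polymorphic
open import Data.Fin.Base using (toℕ)
open import Data.Fin.Properties using (pigeonhole)
open import Data.List.Base using (List; []; _∷_; _∷ʳ_; _++_; map; length; filter; lookup; applyUpTo)
open import Data.List.Membership.Propositional.Properties
  using (∈-map⁺; ∈-++⁺ˡ; ∈-++⁺ʳ; ∈-filter⁺; ∈-filter⁻)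
import Data.List.Membership.Propositional as List
open import Data.List.Properties using (length-applyUpTo; applyUpTo-∷ʳ; filter-notAll)
open import Data.List.Relation.Unary.All as All using (All; []; _∷_)
open import Data.List.Relation.Unary.AllPairs using (_∷_)
open import Data.List.Relation.Unary.Any as Any using (here; there; index)
open import Data.List.Relation.Unary.Any.Properties using (lookup-index)
open import Data.List.Relation.Unary.Linked using (Linked; [-]; _∷_)
import Data.List.Relation.Unary.Linked.Properties as Linked
import Data.List.Relation.Unary.Unique.Propositional.Properties as Unique
open import Data.Nat.Base as ℕ using (suc; s≤s; z≤n; _∸_)
open import Data.Nat.GeneralisedArithmetic using (fold; fold-+)
open import Data.Nat.Induction using (<-rec)
import Data.Nat.Properties as ℕ
open import Data.Product.Base as × using (Σ-syntax; ∃; ∃-syntax; _×_; _,_; proj₁; proj₂)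
open import Data.Sum.Base as ⊎ using (_⊎_; inj₁; inj₂; [_,_]; [_,_]′)
open import Data.Unit.Base using (⊤; tt)
open import Function.Base using (_∘_; const; id)
open import Level using (Level; 0ℓ; _⊔_) renaming (suc to lsuc)
open import Relation.Binary.Construct.Closure.ReflexiveTransitive using (Star; ε; _◅_; _◅◅_; gmap; reverse)
import Relation.Binary.Construct.Flip.EqAndOrd as Flip
open import Relation.Binary.Core using (Rel)
open import Relation.Binary.Definitions using (_Respects_; Symmetric; Irreflexive)
open import Relation.Binary.Structures using (IsPartialOrder)
open import Relation.Binary.PropositionalEquality
  using (_≡_; _≢_; refl; sym; trans; cong; subst; module ≡-Reasoning)
open import Relation.Nullary using (¬_; yes; no; contradiction)
open import Relation.Nullary.Decidable using (decidable-stable)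
open import Relation.Unary using (Pred; _∈_; _∉_; _⊆_; _∪_; _∖_; ｛_｝; _≐_)

private
  variable
    a p : Level

-- Bridges in finite graphs.

-- A bridge is witnessed by a cut with a single edge instead of by deleting the edge, because a
-- colouring of the nodes extends easily over a graft.
record Bridge {V : Set} (E : Rel V 0ℓ) (x y : V) : Set where
  field
    side      : V → Bool
    separates : side x ≢ side y
    only      : ∀ {u w} → E u w →
                side u ≡ side w ⊎ (u ≡ x × w ≡ y) ⊎ (u ≡ y × w ≡ x)

module _ (G : FiniteGraph) where

  open FiniteGraph G

  -- A cycle through a bridge would have to cross it a second time.
  bridges⇒acyclic : (∀ {x y} → E x y → Bridge E x y) → ∀ v vs → ¬ IsCycle v vs
  bridges⇒acyclic bridge v [] c with IsCycle.long c
  ... | s≤s ()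
  bridges⇒acyclic bridge v (y ∷ []) c with IsCycle.long c
  ... | s≤s (s≤s ())
  bridges⇒acyclic bridge v (y ∷ w ∷ ws) c
    with IsCycle.simple c | IsCycle.closed c
  ... | (v≢y ∷ v≢ws) ∷ y≢ws ∷ _ | vy ∷ yw ∷ walk =
    separates (sym (trans yw-side (constant v≢ws y≢ws walk)))
    where
    open Bridge (bridge vy)
    -- `step` excludes edges that start at y, so the edge yw is treated on its own.
    yw-side : side y ≡ side w
    yw-side with only yw
    ... | inj₁ eq                 = eq
    ... | inj₂ (inj₁ (y≡v , _))   = contradiction (sym y≡v) v≢y
    ... | inj₂ (inj₂ (_ , w≡v))   = contradiction (sym w≡v) (All.head v≢ws)
    step : ∀ {u u′} → v ≢ u → y ≢ u → E u u′ → side u ≡ side u′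
    step v≢u y≢u e with only e
    ... | inj₁ eq               = eq
    ... | inj₂ (inj₁ (u≡v , _)) = contradiction (sym u≡v) v≢u
    ... | inj₂ (inj₂ (u≡y , _)) = contradiction (sym u≡y) y≢u
    constant : ∀ {u us} → All (v ≢_) (u ∷ us) → All (y ≢_) (u ∷ us) →
               Linked E (u ∷ us ∷ʳ v) → side u ≡ side v
    constant {us = []}    (v≢u ∷ _)    (y≢u ∷ _)    (e ∷ _)    = step v≢u y≢u e
    constant {us = _ ∷ _} (v≢u ∷ v≢us) (y≢u ∷ y≢us) (e ∷ walk) =
      trans (step v≢u y≢u e) (constant v≢us y≢us walk)

  -- Periodic orbits of a map on the nodes.

  module _ (f : V → V) where

    fold-shift : ∀ v {i j} → i ℕ.< j → fold v f j ≡ fold (fold v f i) f (j ∸ i)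
    fold-shift v {i} {j} i<j = begin
      fold v f j              ≡⟨ cong (fold v f) (ℕ.m∸n+n≡m (ℕ.<⇒≤ i<j)) ⟨
      fold v f (j ∸ i ℕ.+ i)  ≡⟨ fold-+ v f (j ∸ i) ⟩
      fold (fold v f i) f (j ∸ i) ∎
      where open ≡-Reasoning

    -- Among one more iterates than `vertices` has entries, two get the same index and so coincide;
    -- their distance is the period.
    periodic-point : V → ∃[ k ] 0 ℕ.< k × ∃[ v ] fold v f k ≡ v
    periodic-point v
      with i , j , i<j , eq ← pigeonhole (ℕ.n<1+n (length vertices))
                                (λ i → index (enumerates (fold v f (toℕ i))))
      = toℕ j ∸ toℕ i , ℕ.m<n⇒0<n∸m i<j , fold v f (toℕ i)
      , trans (sym (fold-shift v i<j)) (sym same)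
      where
      same : fold v f (toℕ i) ≡ fold v f (toℕ j)
      same = trans (lookup-index (enumerates (fold v f (toℕ i))))
            (trans (cong (lookup vertices) eq)
                   (sym (lookup-index (enumerates (fold v f (toℕ j))))))

    -- An orbit of least period repeats no node, hence is a cycle: period 1 would be a loop and
    -- period 2 a backtrack.
    nonbacktracking⇒cycle : (∀ {a} → ExcludedMiddle a) →
      (∀ v → E v (f v)) → (∀ v → f (f v) ≢ v) → V → ∃ λ v → ∃ (IsCycle v)
    nonbacktracking⇒cycle em edge nonbacktracking v₀
      with k , 0<k , v , periodic ← periodic-point v₀ = shortest k 0<k v periodic
      where
      Cycle : Set
      Cycle = ∃ λ v → ∃ (IsCycle v)
      shortest : ∀ k → 0 ℕ.< k → ∀ v → fold v f k ≡ v → Cycle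
      shortest = <-rec _ λ
        { 0 rec () v eq
        ; 1 rec 0<k v eq → contradiction (sym eq) (λ eq → irreflexive eq (edge v))
        ; 2 rec 0<k v eq → contradiction eq (nonbacktracking v)
        ; k@(suc k-1@(suc (suc _))) rec 0<k v eq → cycle k k-1 refl (s≤s (s≤s (s≤s z≤n))) rec v eq }
        where
        cycle : ∀ k k-1 → k ≡ suc k-1 → 3 ℕ.≤ k →
                (∀ {j} → j ℕ.< k → 0 ℕ.< j → ∀ v → fold v f j ≡ v → Cycle) →
                ∀ v → fold v f k ≡ v → Cycle
        cycle k k-1 refl 3≤k rec v eq
          -- The period is compared with those of all nodes, since a repetition among the iterates
          -- of v appears as a shorter period of the iterate `fold v f i`.
          with em {P = ∃ λ j → j ℕ.< k × 0 ℕ.< j × ∃ λ u → fold u f j ≡ u}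
        ... | yes (j , j<k , 0<j , u , eq′) = rec j<k 0<j u eq′
        ... | no minimal = v , applyUpTo (fold v f ∘ suc) k-1 , record
          { long   = subst (3 ℕ.≤_) (sym (length-applyUpTo (fold v f) k)) 3≤k
          ; simple = Unique.applyUpTo⁺₁ (fold v f) k λ {i} {j} i<j j<k same → minimal
              ( j ∸ i , ℕ.≤-<-trans (ℕ.m∸n≤m j i) j<k , ℕ.m<n⇒0<n∸m i<j , fold v f i
              , trans (sym (fold-shift v i<j)) (sym same))
          ; closed = subst (Linked E)
              (trans (sym (applyUpTo-∷ʳ (fold v f) k)) (cong (applyUpTo (fold v f) k ∷ʳ_) eq))
              (Linked.applyUpTo⁺₂ (fold v f) (suc k) λ i → edge (fold v f i))
          }

-- Minimal elements in classical logic.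

module _ (em : ∀ {a} → ExcludedMiddle a) where

  dne : {P : Set p} → ¬ ¬ P → P
  dne = decidable-stable em

  module _ {A : Set a} {_⊑_ : Rel A p} (po : IsPartialOrder _≡_ _⊑_) where

    private module ⊑ = IsPartialOrder po

    -- `xs` covers what lies in `Q` strictly below the current y. If its head does, move down to it;
    -- either way the head is then no longer a candidate and the list shrinks.
    minimal-below : ∀ {q} {Q : Pred A q} xs {y} → y ∈ Q →
      (∀ {z} → z ∈ Q → z ⊑ y → z ≢ y → z List.∈ xs) →
      ∃[ m ] m ∈ Q × m ⊑ y × (∀ {z} → z ∈ Q → z ⊑ m → z ≡ m)
    minimal-below [] {y} y∈Q below = y , y∈Q , ⊑.refl , λ z∈Q z⊑y →
      dne λ z≢y → case-[] (below z∈Q z⊑y z≢y)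
      where
      case-[] : ∀ {z} → ¬ z List.∈ []
      case-[] ()
    minimal-below {Q = Q} (x ∷ xs) {y} y∈Q below with em {P = x ∈ Q × x ⊑ y × x ≢ y}
    ... | yes (x∈Q , x⊑y , x≢y) =
      let m , m∈Q , m⊑x , least = minimal-below xs x∈Q λ z∈Q z⊑x z≢x →
            Any.tail z≢x (below z∈Q (⊑.trans z⊑x x⊑y)
              λ { refl → x≢y (⊑.antisym x⊑y z⊑x) })
      in m , m∈Q , ⊑.trans m⊑x x⊑y , least
    ... | no fails = minimal-below xs y∈Q λ z∈Q z⊑y z≢y →
      Any.tail (λ { refl → fails (z∈Q , z⊑y , z≢y) }) (below z∈Q z⊑y z≢y)

  -- Lattices with an order-reversing involution.

  module _ {c ℓ : Level} (U : Universe c ℓ) where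

    open Universe U
      renaming (refl to ≤-refl; trans to ≤-trans; antisym to ≤-antisym)
      hiding (module Eq; isEquivalence; reflexive)
    open Separations U

    *-swap : ∀ {x y} → x * ≡ y → x ≡ y *
    *-swap refl = sym (*-involutive _)

    *-injective : ∀ {x y} → x * ≡ y * → x ≡ y
    *-injective eq = trans (*-swap eq) (*-involutive _)

    ≤-swapʳ : ∀ {x y} → x ≤ y * → y ≤ x *
    ≤-swapʳ x≤y* = subst (_≤ _) (*-involutive _) (*-antitone x≤y*)

    ≤-swapˡ : ∀ {x y} → x * ≤ y → y * ≤ x
    ≤-swapˡ x*≤y = subst (_ ≤_) (*-involutive _) (*-antitone x*≤y)

    ≤-reflexive : ∀ {x y} → x ≡ y → x ≤ y
    ≤-reflexive refl = ≤-refl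

    deMorgan : ∀ x y → (x ∨ y) * ≡ x * ∧ y *
    deMorgan x y = ≤-antisym
      (∧-greatest (*-antitone (x≤x∨y x y)) (*-antitone (y≤x∨y x y)))
      (≤-swapʳ (∨-least (≤-swapʳ (x∧y≤x (x *) (y *))) (≤-swapʳ (x∧y≤y (x *) (y *)))))

    deMorgan-∧ : ∀ x y → (x ∧ y) * ≡ x * ∨ y *
    deMorgan-∧ x y = ≤-antisym
      (≤-swapˡ (∧-greatest (≤-swapˡ (x≤x∨y (x *) (y *))) (≤-swapˡ (y≤x∨y (x *) (y *)))))
      (∨-least (*-antitone (x∧y≤x x y)) (*-antitone (x∧y≤y x y)))

    y≤x⇒x∧y≡y : ∀ {x y} → y ≤ x → x ∧ y ≡ y
    y≤x⇒x∧y≡y {x} {y} y≤x = ≤-antisym (x∧y≤y x y) (∧-greatest y≤x ≤-refl)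

    ∨-comm : ∀ x y → x ∨ y ≡ y ∨ x
    ∨-comm x y = ≤-antisym
      (∨-least (y≤x∨y y x) (x≤x∨y y x)) (∨-least (y≤x∨y x y) (x≤x∨y x y))

    x≤y⇒x∨y≡y : ∀ {x y} → x ≤ y → x ∨ y ≡ y
    x≤y⇒x∨y≡y {x} {y} x≤y = ≤-antisym (∨-least x≤y ≤-refl) (y≤x∨y x y)

    -- Trivial separations, and emulators from submodularity.

    module _ (S : Subset) (closed : IsSeparationSystem S) where

      -- Otherwise y would witness that r is trivial.
      between-orientations : ∀ {r y} → r ∈ S → y ∈ S → ¬ TrivialIn S r →
                             r ≤ y → r ≤ y * → y ≡ r ⊎ y ≡ r *
      between-orientations {r} {y} r∈S y∈S nontrivial r≤y r≤y* with em {P = y ≡ r} | em {P = y ≡ r *}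
      ... | yes y≡r | _        = inj₁ y≡r
      ... | no _    | yes y≡r* = inj₂ y≡r*
      ... | no y≢r  | no y≢r*  = contradiction
        (r∈S , y , y∈S , (r≤y , y≢r ∘ sym) , (r≤y* , y≢r* ∘ *-swap ∘ sym)) nontrivial

      module _ (xs : List Carrier) (enumerates : ∀ {x} → x ∈ S → x List.∈ xs)
               (submodular : Submodular S) where

        -- Let s be maximal in `Q` above r. By De Morgan, s * emulates r′ once s has its meets with
        -- all elements of S below r′ *; `meets` derives these from maximality.
        separating : ∀ {r r′} → r ∈ S → r′ ∈ S → r ≤ r′ * →
                     ∃[ s ] Emulates S s r × Emulates S (s *) r′
        separating {r} {r′} r∈S r′∈S r≤r′* =
          let s , (s∈S , s≤r′* , joins) , r≤s , maximal = minimal-below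
                (Flip.isPartialOrder isPartialOrder) {Q = Q} xs
                (r∈S , r≤r′* , λ t∈S r≤t → subst (_∈ S) (sym (x≤y⇒x∨y≡y r≤t)) t∈S)
                (λ z∈Q _ _ → enumerates (proj₁ z∈Q))
          in s , (s∈S , r≤s , λ t∈S _ → joins t∈S)
               , (closed s∈S , ≤-swapʳ s≤r′* , λ {t} t∈S _ r′≤t →
                  subst (_∈ S)
                    (trans (deMorgan-∧ s (t *)) (cong (s * ∨_) (*-involutive t)))
                    (closed (meets s∈S s≤r′* joins maximal (closed t∈S) (*-antitone r′≤t))))
          where
          -- Unlike in `Emulates`, t = r * is not exempt, and r ≤ s is left to the search, which
          -- only moves up from r.
          Q : Pred Carrier _
          Q s = s ∈ S × s ≤ r′ * × (∀ {t} → t ∈ S → r ≤ t → s ∨ t ∈ S)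

          module _ {s} (s∈S : s ∈ S) (s≤r′* : s ≤ r′ *)
                   (joins : ∀ {t} → t ∈ S → r ≤ t → s ∨ t ∈ S)
                   (maximal : ∀ {t} → t ∈ Q → s ≤ t → t ≡ s) where

            -- For a minimal t whose meet with s fails, submodularity gives s ∨ t ∈ S, and s ∨ t is
            -- again in `Q`. Maximality then forces t ≤ s, so the meet is t, which lies in S.
            meets : ∀ {t} → t ∈ S → t ≤ r′ * → s ∧ t ∈ S
            meets t∈S t≤r′* = dne λ s∧t∉S →
              let t , (t∈S , t≤r′* , s∧t∉S) , _ , least = minimal-below isPartialOrder
                    {Q = λ t → t ∈ S × t ≤ r′ * × s ∧ t ∉ S} xs
                    (t∈S , t≤r′* , s∧t∉S) (λ z _ _ → enumerates (proj₁ z))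
              in minimal-failure t∈S t≤r′* s∧t∉S least
              where
              minimal-failure : ∀ {t} → t ∈ S → t ≤ r′ * → s ∧ t ∉ S →
                (∀ {u} → u ∈ S × u ≤ r′ * × s ∧ u ∉ S → u ≤ t → u ≡ t) → ⊥
              minimal-failure {t} t∈S t≤r′* s∧t∉S least =
                s∧t∉S (subst (_∈ S) (sym (y≤x⇒x∧y≡y t≤s)) t∈S)
                where
                s∨t∈S : s ∨ t ∈ S
                s∨t∈S = [ id , ⊥-elim ∘ s∧t∉S ]′ (submodular s∈S t∈S)
                joins′ : ∀ {u} → u ∈ S → r ≤ u → (s ∨ t) ∨ u ∈ S
                joins′ {u} u∈S r≤u = [ subst (_∈ S) t∨[s∨u]≡[s∨t]∨u , via-meet ]′
                  (submodular t∈S (joins u∈S r≤u))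
                  where
                  t∨[s∨u]≡[s∨t]∨u : t ∨ (s ∨ u) ≡ (s ∨ t) ∨ u
                  t∨[s∨u]≡[s∨t]∨u = ≤-antisym
                    (∨-least (≤-trans (y≤x∨y s t) (x≤x∨y _ u))
                      (∨-least (≤-trans (x≤x∨y s t) (x≤x∨y _ u)) (y≤x∨y _ u)))
                    (∨-least (∨-least (≤-trans (x≤x∨y s u) (y≤x∨y t _)) (x≤x∨y t _))
                      (≤-trans (y≤x∨y s u) (y≤x∨y t _)))
                  -- The element t ∧ (s ∨ u) has the same meet with s as t has, so by minimality it
                  -- is t. Hence t ≤ s ∨ u, and the join sought is s ∨ u.
                  via-meet : t ∧ (s ∨ u) ∈ S → (s ∨ t) ∨ u ∈ S
                  via-meet m∈S = subst (_∈ S)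
                    (≤-antisym
                      (∨-least (≤-trans (x≤x∨y s t) (x≤x∨y _ u)) (y≤x∨y _ u))
                      (∨-least (∨-least (x≤x∨y s u) t≤s∨u) (y≤x∨y s u)))
                    (joins u∈S r≤u)
                    where
                    s∧m≡s∧t : s ∧ (t ∧ (s ∨ u)) ≡ s ∧ t
                    s∧m≡s∧t = ≤-antisym
                      (∧-greatest (x∧y≤x _ _) (≤-trans (x∧y≤y _ _) (x∧y≤x _ _)))
                      (∧-greatest (x∧y≤x _ _)
                        (∧-greatest (x∧y≤y _ _) (≤-trans (x∧y≤x _ _) (x≤x∨y s u))))
                    t≤s∨u : t ≤ s ∨ u
                    t≤s∨u = subst (_≤ s ∨ u)
                      (least (m∈S , ≤-trans (x∧y≤x _ _) t≤r′* , s∧t∉S ∘ subst (_∈ S) s∧m≡s∧t)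
                        (x∧y≤x t (s ∨ u)))
                      (x∧y≤y t (s ∨ u))
                t≤s : t ≤ s
                t≤s = subst (t ≤_)
                  (maximal (s∨t∈S , ∨-least s≤r′* t≤r′* , joins′) (x≤x∨y s t)) (y≤x∨y s t)

      -- Rooted labelled trees and their S-trees.

      data RootedTree : Set c where
        •     : RootedTree
        -- graft T a∈S T′ joins the roots of T and T′ by an edge, with label a
        -- when directed towards T; the root is that of T.
        graft : RootedTree → ∀ {a} → a ∈ S → RootedTree → RootedTree

      Node : RootedTree → Set
      Node •             = ⊤
      Node (graft T _ T′) = Node T ⊎ Node T′

      root : ∀ T → Node T
      root •             = tt
      root (graft T _ _) = inj₁ (root T)

      Adjacent : ∀ T → Rel (Node T) 0ℓ
      Adjacent •              _        _        = ⊥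
      Adjacent (graft T _ T′) (inj₁ x) (inj₁ y) = Adjacent T x y
      Adjacent (graft T _ T′) (inj₁ x) (inj₂ y) = x ≡ root T × y ≡ root T′
      Adjacent (graft T _ T′) (inj₂ x) (inj₁ y) = x ≡ root T′ × y ≡ root T
      Adjacent (graft T _ T′) (inj₂ x) (inj₂ y) = Adjacent T′ x y

      label : ∀ T {x y} → Adjacent T x y → Carrier
      label (graft T _ T′)     {inj₁ x} {inj₁ y} e = label T e
      label (graft T {a} _ T′) {inj₁ x} {inj₂ y} e = a *
      label (graft T {a} _ T′) {inj₂ x} {inj₁ y} e = a
      label (graft T _ T′)     {inj₂ x} {inj₂ y} e = label T′ e

      label∈S : ∀ T {x y} (e : Adjacent T x y) → label T e ∈ S
      label∈S (graft T _ T′)   {inj₁ x} {inj₁ y} e = label∈S T e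
      label∈S (graft T a∈S T′) {inj₁ x} {inj₂ y} e = closed a∈S
      label∈S (graft T a∈S T′) {inj₂ x} {inj₁ y} e = a∈S
      label∈S (graft T _ T′)   {inj₂ x} {inj₂ y} e = label∈S T′ e

      label-* : ∀ T {x y} (e : Adjacent T x y) (e′ : Adjacent T y x) → label T e′ ≡ label T e *
      label-* (graft T _ T′) {inj₁ x} {inj₁ y} e e′ = label-* T e e′
      label-* (graft T _ T′) {inj₁ x} {inj₂ y} e e′ = sym (*-involutive _)
      label-* (graft T _ T′) {inj₂ x} {inj₁ y} e e′ = refl
      label-* (graft T _ T′) {inj₂ x} {inj₂ y} e e′ = label-* T′ e e′

      nodes : ∀ T → List (Node T)
      nodes •              = tt ∷ []
      nodes (graft T _ T′) = map inj₁ (nodes T) ++ map inj₂ (nodes T′)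

      ∈-nodes : ∀ T x → x List.∈ nodes T
      ∈-nodes •              tt       = here refl
      ∈-nodes (graft T _ T′) (inj₁ x) = ∈-++⁺ˡ (∈-map⁺ inj₁ (∈-nodes T x))
      ∈-nodes (graft T _ T′) (inj₂ x) = ∈-++⁺ʳ _ (∈-map⁺ inj₂ (∈-nodes T′ x))

      adjacent-sym : ∀ T → Symmetric (Adjacent T)
      adjacent-sym (graft T _ T′) {inj₁ x} {inj₁ y} e       = adjacent-sym T e
      adjacent-sym (graft T _ T′) {inj₁ x} {inj₂ y} (p , q) = q , p
      adjacent-sym (graft T _ T′) {inj₂ x} {inj₁ y} (p , q) = q , p
      adjacent-sym (graft T _ T′) {inj₂ x} {inj₂ y} e       = adjacent-sym T′ e

      adjacent-irrefl : ∀ T → Irreflexive _≡_ (Adjacent T)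
      adjacent-irrefl (graft T _ T′) {inj₁ x} refl e = adjacent-irrefl T refl e
      adjacent-irrefl (graft T _ T′) {inj₂ x} refl e = adjacent-irrefl T′ refl e

      to-root : ∀ T x → Star (Adjacent T) x (root T)
      to-root •              tt       = ε
      to-root (graft T _ T′) (inj₁ x) = gmap inj₁ id (to-root T x)
      to-root (graft T _ T′) (inj₂ x) = gmap inj₂ id (to-root T′ x) ◅◅ (refl , refl) ◅ ε

      -- The new edge separates the two parts. A bridge inside one part stays a bridge if the other
      -- part gets the colour of the root to which it is attached.
      bridge : ∀ T {x y} → Adjacent T x y → Bridge (Adjacent T) x y
      bridge (graft T _ T′) {inj₁ x} {inj₁ y} e = record
        { side      = [ side , const (side (root T)) ]
        ; separates = separates
        ; only      = λ
          { {inj₁ _} {inj₁ _} e           → ⊎.map₂ (⊎.map inj₁-pair inj₁-pair) (only e)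
          ; {inj₁ _} {inj₂ _} (refl , _)  → inj₁ refl
          ; {inj₂ _} {inj₁ _} (_ , refl)  → inj₁ refl
          ; {inj₂ _} {inj₂ _} _           → inj₁ refl }
        }
        where
        open Bridge (bridge T e)
        inj₁-pair : ∀ {u v w z} → u ≡ v × w ≡ z → inj₁ u ≡ inj₁ v × inj₁ w ≡ inj₁ z
        inj₁-pair = ×.map (cong inj₁) (cong inj₁)
      bridge (graft T _ T′) {inj₁ x} {inj₂ y} (refl , refl) = record
        { side      = [ const true , const false ]
        ; separates = λ ()
        ; only      = λ
          { {inj₁ _} {inj₁ _} _             → inj₁ refl
          ; {inj₁ _} {inj₂ _} (refl , refl) → inj₂ (inj₁ (refl , refl))
          ; {inj₂ _} {inj₁ _} (refl , refl) → inj₂ (inj₂ (refl , refl))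
          ; {inj₂ _} {inj₂ _} _             → inj₁ refl }
        }
      bridge (graft T _ T′) {inj₂ x} {inj₁ y} (refl , refl) = record
        { side      = [ const true , const false ]
        ; separates = λ ()
        ; only      = λ
          { {inj₁ _} {inj₁ _} _             → inj₁ refl
          ; {inj₁ _} {inj₂ _} (refl , refl) → inj₂ (inj₂ (refl , refl))
          ; {inj₂ _} {inj₁ _} (refl , refl) → inj₂ (inj₁ (refl , refl))
          ; {inj₂ _} {inj₂ _} _             → inj₁ refl }
        }
      bridge (graft T _ T′) {inj₂ x} {inj₂ y} e = record
        { side      = [ const (side (root T′)) , side ]
        ; separates = separates
        ; only      = λ
          { {inj₁ _} {inj₁ _} _           → inj₁ refl
          ; {inj₁ _} {inj₂ _} (_ , refl)  → inj₁ refl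
          ; {inj₂ _} {inj₁ _} (refl , _)  → inj₁ refl
          ; {inj₂ _} {inj₂ _} e           → ⊎.map₂ (⊎.map inj₂-pair inj₂-pair) (only e) }
        }
        where
        open Bridge (bridge T′ e)
        inj₂-pair : ∀ {u v w z} → u ≡ v × w ≡ z → inj₂ u ≡ inj₂ v × inj₂ w ≡ inj₂ z
        inj₂-pair = ×.map (cong inj₂) (cong inj₂)

      graph : RootedTree → FiniteGraph
      graph T = record
        { V           = Node T
        ; E           = Adjacent T
        ; symmetric   = adjacent-sym T
        ; irreflexive = adjacent-irrefl T
        ; vertices    = nodes T
        ; enumerates  = ∈-nodes T
        }

      sTree : RootedTree → STree S
      sTree T = record
        { T      = graph T
        ; isTree = record
          { node      = root T
          ; connected = λ x y → to-root T x ◅◅ reverse (adjacent-sym T) (to-root T y)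
          ; acyclic   = bridges⇒acyclic (graph T) (bridge T)
          }
        ; α      = label T
        ; α∈S    = label∈S T
        ; α-*    = label-* T
        }

      incoming : ∀ T → Node T → Subset
      incoming T = STree.αF (sTree T)

      -- Stars at the nodes of a graft.

      module _ (T : RootedTree) {a : Carrier} (a∈S : a ∈ S) (T′ : RootedTree) where

        incoming-inj₁ : ∀ {t} → t ≢ root T → incoming T t ≐ incoming (graft T a∈S T′) (inj₁ t)
        incoming-inj₁ t≢root = (λ { (s , e , eq) → inj₁ s , e , eq }) , λ
          { (inj₁ s , e , eq) → s , e , eq
          ; (inj₂ s , (_ , t≡root) , _) → contradiction t≡root t≢root }

        incoming-inj₂ : ∀ {t} → t ≢ root T′ → incoming T′ t ≐ incoming (graft T a∈S T′) (inj₂ t)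
        incoming-inj₂ t≢root = (λ { (s , e , eq) → inj₂ s , e , eq }) , λ
          { (inj₁ s , (_ , t≡root) , _) → contradiction t≡root t≢root
          ; (inj₂ s , e , eq) → s , e , eq }

        incoming-root₁ : incoming T (root T) ∪ ｛ a ｝ ≐ incoming (graft T a∈S T′) (inj₁ (root T))
        incoming-root₁ =
            [ (λ { (s , e , eq) → inj₁ s , e , eq })
            , (λ { refl → inj₂ (root T′) , (refl , refl) , refl }) ]′
          , λ { (inj₁ s , e , eq) → inj₁ (s , e , eq)
              ; (inj₂ s , _ , eq) → inj₂ (sym eq) }

        incoming-root₂ : incoming T′ (root T′) ∪ ｛ a * ｝ ≐ incoming (graft T a∈S T′) (inj₂ (root T′))
        incoming-root₂ =
            [ (λ { (s , e , eq) → inj₂ s , e , eq })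
            , (λ { refl → inj₁ (root T) , (refl , refl) , refl }) ]′
          , λ { (inj₁ s , _ , eq) → inj₂ (sym eq)
              ; (inj₂ s , e , eq) → inj₁ (s , e , eq) }

      -- Unit propagation over a family of stars.

      module _ {f : Level} (F : Family f) (stars : ∀ {σ} → σ ∈ F → IsStar σ) where

        -- Unit propagation: every F-tangle containing P contains Forced P. A
        -- derivation of z is an S-tree behind an edge labelled z whose leaves may
        -- also be stars {p *} with p in P.
        data Forced (P : Subset) : Carrier → Set (lsuc c ⊔ f) where
          axm : ∀ {z} → z ∈ P → Forced P z
          node : ∀ {σ x} → σ ∈ F → σ ⊆ S → x ∈ σ →
                 (∀ {y} → y ∈ σ → y ≢ x → Forced P y) → Forced P (x *)

        Conflict : Subset → Set (lsuc c ⊔ f)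
        Conflict P = ∃[ σ ] σ ∈ F × σ ⊆ S × (∀ {y} → y ∈ σ → Forced P y)

        -- As z is not an axiom, it is derived from a star whose only element not yet derived is
        -- some x with z = x *; that x is z *.
        cut : ∀ {P z} → z ∉ P → Forced P z → Forced P (z *) → Conflict P
        cut z∉P (axm z∈P) _ = contradiction z∈P z∉P
        cut {P} _ (node {σ} {x} σ∈F σ⊆S x∈σ rest) forced = σ , σ∈F , σ⊆S , all
          where
          all : ∀ {y} → y ∈ σ → Forced P y
          all {y} y∈σ with em {P = y ≡ x}
          ... | yes refl = subst (Forced P) (*-involutive x) forced
          ... | no y≢x   = rest y∈σ y≢x

        star-≤ : ∀ {σ x y} → σ ∈ F → x ∈ σ → y ∈ σ → y ≢ x → y ≤ x *
        star-≤ σ∈F x∈σ y∈σ y≢x = proj₂ (stars σ∈F) y∈σ x∈σ y≢x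

        module _ {P P′ : Subset} (derive : ∀ {z} → z ∈ P′ → Forced P z ⊎ Degenerate z) where

          -- Derivations are substituted for axioms. A degenerate axiom may stay underived: a star
          -- has no degenerate elements, so it is never a premise.
          rederive : ∀ {z} → Forced P′ z → Forced P z ⊎ Degenerate z
          rederive (axm z∈P′) = derive z∈P′
          rederive (node σ∈F σ⊆S x∈σ rest) = inj₁ (node σ∈F σ⊆S x∈σ λ y∈σ y≢x →
            [ id , ⊥-elim ∘ proj₁ (stars σ∈F) y∈σ ]′ (rederive (rest y∈σ y≢x)))

          conflict-rederive : Conflict P′ → Conflict P
          conflict-rederive (σ , σ∈F , σ⊆S , forced) = σ , σ∈F , σ⊆S , λ y∈σ →
            [ id , ⊥-elim ∘ proj₁ (stars σ∈F) y∈σ ]′ (rederive (forced y∈σ))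

        -- Derivations with one additional axiom r.

        module _ {P : Subset} {r : Carrier} (r∈S : r ∈ S)
                 (nontrivial : ¬ TrivialIn S r) (nondegenerate : ¬ Degenerate r) where

          private
            P⁺ : Subset
            P⁺ = P ∪ ｛ r ｝

          -- Labels increase along a derivation, as y ≤ x * within a star; so a conclusion that
          -- depends on the leaf r lies above r.
          forced-or-above : ∀ {z} → Forced P⁺ z → Forced P z ⊎ r ≤ z
          forced-or-above (axm (inj₁ z∈P)) = inj₁ (axm z∈P)
          forced-or-above (axm (inj₂ r≡z)) = inj₂ (≤-reflexive r≡z)
          forced-or-above (node {σ} {x} σ∈F σ⊆S x∈σ rest)
            with em {P = ∃[ y ] y ∈ σ × y ≢ x × ¬ Forced P y}
          ... | no none = inj₁ (node σ∈F σ⊆S x∈σ λ y∈σ y≢x →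
                  dne λ unforced → none (_ , y∈σ , y≢x , unforced))
          ... | yes (y , y∈σ , y≢x , unforced) with forced-or-above (rest y∈σ y≢x)
          ...   | inj₁ forced = contradiction forced unforced
          ...   | inj₂ r≤y    = inj₂ (≤-trans r≤y (star-≤ σ∈F x∈σ y∈σ y≢x))

          -- At the last star x is r. A premise y that depends on the leaf r lies between r and r *,
          -- so by nontriviality it is r *, with a shorter derivation.
          forced-* : ∀ {z} → Forced P⁺ z → z ≡ r * → Forced P z
          forced-* (axm (inj₁ z∈P)) _    = axm z∈P
          forced-* (axm (inj₂ refl)) r≡r* = contradiction r≡r* nondegenerate
          forced-* (node {σ} {x} σ∈F σ⊆S x∈σ rest) x*≡r*
            with refl ← *-injective x*≡r* = node σ∈F σ⊆S x∈σ forced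
            where
            forced : ∀ {y} → y ∈ σ → y ≢ x → Forced P y
            forced y∈σ y≢r with forced-or-above (rest y∈σ y≢r)
            ... | inj₁ forced = forced
            ... | inj₂ r≤y
                with between-orientations r∈S (σ⊆S y∈σ) nontrivial r≤y
                       (≤-swapʳ (star-≤ σ∈F x∈σ y∈σ y≢r))
            ...   | inj₁ y≡r  = contradiction y≡r y≢r
            ...   | inj₂ y≡r* = forced-* (rest y∈σ y≢r) y≡r*

          -- If both y and y′ depended on r, each would be above r and below the inverse of the
          -- other, hence be r or r *. Being distinct, one would be r *, which `forced-*` derives
          -- from P alone.
          unforced-unique : ∀ {σ y y′} → σ ∈ F → σ ⊆ S → y ∈ σ → y′ ∈ σ → y′ ≢ y →
                            Forced P⁺ y → Forced P⁺ y′ → ¬ Forced P y → Forced P y′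
          unforced-unique {y = y} {y′} σ∈F σ⊆S y∈σ y′∈σ y′≢y d d′ unforced
            with forced-or-above d | forced-or-above d′
          ... | inj₁ forced | _           = contradiction forced unforced
          ... | inj₂ _      | inj₁ forced = forced
          ... | inj₂ r≤y    | inj₂ r≤y′
              with between-orientations r∈S (σ⊆S y∈σ) nontrivial r≤y
                     (≤-trans r≤y′ (star-≤ σ∈F y∈σ y′∈σ y′≢y))
                 | between-orientations r∈S (σ⊆S y′∈σ) nontrivial r≤y′
                     (≤-trans r≤y (star-≤ σ∈F y′∈σ y∈σ (y′≢y ∘ sym)))
          ...   | inj₂ y≡r* | _          = contradiction (forced-* d y≡r*) unforced
          ...   | inj₁ _    | inj₂ y′≡r* = forced-* d′ y′≡r*
          ...   | inj₁ refl | inj₁ y′≡r  = contradiction y′≡r y′≢y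

          -- Rerooting: in a derivation with a leaf r, only the path from the root
          -- to that leaf uses r, and turning this path round derives r *.
          reroot : ∀ {z} → Forced P⁺ z → Forced P z ⊎ (Forced P (z *) → Forced P (r *))
          reroot (axm (inj₁ z∈P))  = inj₁ (axm z∈P)
          reroot (axm (inj₂ refl)) = inj₂ id
          reroot (node {σ} {x} σ∈F σ⊆S x∈σ rest)
            with em {P = ∃[ y ] y ∈ σ × y ≢ x × ¬ Forced P y}
          ... | no none = inj₁ (node σ∈F σ⊆S x∈σ λ y∈σ y≢x →
                  dne λ unforced → none (_ , y∈σ , y≢x , unforced))
          ... | yes (y , y∈σ , y≢x , unforced) with reroot (rest y∈σ y≢x)
          ...   | inj₁ forced = contradiction forced unforced
          -- The star is kept, but x now serves as a premise and y * becomes the conclusion.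
          ...   | inj₂ turn   = inj₂ λ forced-x → turn (node σ∈F σ⊆S y∈σ (others forced-x))
            where
            others : Forced P (x * *) → ∀ {y′} → y′ ∈ σ → y′ ≢ y → Forced P y′
            others forced-x {y′} y′∈σ y′≢y with em {P = y′ ≡ x}
            ... | yes refl = subst (Forced P) (*-involutive x) forced-x
            ... | no y′≢x  = unforced-unique σ∈F σ⊆S y∈σ y′∈σ y′≢y
                               (rest y∈σ y≢x) (rest y′∈σ y′≢x) unforced

          -- If one element y of the conflicting star depends on r, the others are forced by P and
          -- yield y *; rerooting the derivation of y then yields r *.
          conflict⇒forced-* : Conflict P⁺ → Conflict P ⊎ Forced P (r *)
          conflict⇒forced-* (σ , σ∈F , σ⊆S , all) with em {P = ∃[ y ] y ∈ σ × ¬ Forced P y}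
          ... | no none = inj₁ (σ , σ∈F , σ⊆S , λ y∈σ → dne λ unforced → none (_ , y∈σ , unforced))
          ... | yes (y , y∈σ , unforced) with reroot (all y∈σ)
          ...   | inj₁ forced = contradiction forced unforced
          ...   | inj₂ turn   = inj₂ (turn (node σ∈F σ⊆S y∈σ λ y′∈σ y′≢y →
                    unforced-unique σ∈F σ⊆S y∈σ y′∈σ y′≢y (all y∈σ) (all y′∈σ) unforced))

        -- Shifting derivations.

        -- The working form of consistency for partial orientations; it also keeps shifted axioms z
        -- ∧ s * in P.
        DownClosed : Subset → Set (c ⊔ ℓ)
        DownClosed P = ∀ {z p} → z ∈ S → p ∈ P → z ≤ p → z ∈ P

        module _ {P : Subset} (P-down : DownClosed P) {r s : Carrier} (r∉P : r ∉ P)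
                 (unforced : ¬ Forced P r) (P⊆S : P ⊆ S)
                 (emulatesFor : EmulatesFor S F s r) where

          private
            s∈S : s ∈ S
            s∈S = proj₁ (proj₁ emulatesFor)

            joins : ∀ {t} → t ∈ S → t ≢ r * → r ≤ t → s ∨ t ∈ S
            joins = proj₂ (proj₂ (proj₁ emulatesFor))

            meets : ∀ {z} → z ∈ S → z ≢ r → r ≤ z * → z ∧ s * ∈ S
            meets {z} z∈S z≢r r≤z* = subst (_∈ S) eq
              (closed (joins (closed z∈S) (z≢r ∘ *-injective) r≤z*))
              where
              eq : (s ∨ z *) * ≡ z ∧ s *
              eq = trans (cong _* (∨-comm s (z *)))
                  (trans (deMorgan (z *) s) (cong (_∧ s *) (*-involutive z)))

          -- Every label z becomes z ∧ s *, and (x ∨ s) * = x * ∧ s * fits the shifted star. The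
          -- condition r ≤ z * passes to the premises because r ≤ x ≤ y *.
          shift-forced : ∀ {z} → Forced P z → r ≤ z * → Forced P (z ∧ s *)
          shift-forced (axm z∈P) r≤z* = axm (P-down
            (meets (P⊆S z∈P) (λ { refl → r∉P z∈P }) r≤z*) z∈P (x∧y≤x _ _))
          shift-forced d@(node {σ} {x} σ∈F σ⊆S x∈σ rest) r≤x** with em {P = r * ∈ σ} | em {P = x ≡ r *}
          ... | yes _    | yes refl =
              contradiction (subst (Forced P) (*-involutive r) d) unforced
          -- `EmulatesFor` does not cover stars containing r *. Here x = r, so the conclusion
          -- repeats the premise r *, whose shorter derivation is shifted instead.
          ... | yes r*∈σ | no x≢r*  =
              subst (λ z → Forced P (z ∧ s *)) (cong _* (≤-antisym r≤x x≤r))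
                (shift-forced (rest r*∈σ (x≢r* ∘ sym)) (≤-reflexive (sym (*-involutive r))))
              where
              r≤x : r ≤ x
              r≤x = subst (r ≤_) (*-involutive x) r≤x**
              x≤r : x ≤ r
              x≤r = subst (x ≤_) (*-involutive r) (star-≤ σ∈F r*∈σ x∈σ x≢r*)
          ... | no r*∉σ | _ = subst (Forced P) (deMorgan x s)
              (node (proj₂ emulatesFor (stars σ∈F) σ⊆S∖r* σ∈F x∈σ r≤x) shift⊆S (inj₁ refl) children)
              where
              r≤x : r ≤ x
              r≤x = subst (r ≤_) (*-involutive x) r≤x**
              σ⊆S∖r* : σ ⊆ S ∖ ｛ r * ｝
              σ⊆S∖r* y∈σ = σ⊆S y∈σ , λ { refl → r*∉σ y∈σ }
              r≤y* : ∀ {y} → y ∈ σ → y ≢ x → r ≤ y *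
              r≤y* y∈σ y≢x = ≤-trans r≤x (star-≤ σ∈F y∈σ x∈σ (y≢x ∘ sym))
              shift⊆S : shift σ x s ⊆ S
              shift⊆S (inj₁ refl) = subst (_∈ S)
                (∨-comm s x)
                (joins (σ⊆S x∈σ) (λ { refl → r*∉σ x∈σ }) r≤x)
              shift⊆S (inj₂ (y , y∈σ , y≢x , refl)) =
                meets (σ⊆S y∈σ) (λ { refl → unforced (rest y∈σ y≢x) }) (r≤y* y∈σ y≢x)
              children : ∀ {z} → z ∈ shift σ x s → z ≢ x ∨ s → Forced P z
              children (inj₁ refl) z≢z = contradiction refl z≢z
              children (inj₂ (y , y∈σ , y≢x , refl)) _ = shift-forced (rest y∈σ y≢x) (r≤y* y∈σ y≢x)

        -- Combining two conflicts.

        module _ (xs : List Carrier) (enumerates : ∀ {x} → x ∈ S → x List.∈ xs)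
                 (submodular : Submodular S) (standard : Standard S F)
                 (shifting : ClosedUnderShifting S F) where

          module _ {P : Subset} (P⊆S : P ⊆ S) (P-down : DownClosed P) where

            -- A degenerate r is never a premise, and if the singleton star of r * is in F, then r
            -- is forced outright. Otherwise r is nontrivial by standardness, and closure under
            -- shifting applies.
            conflict-extension : ∀ {r} → r ∈ S → Conflict (P ∪ ｛ r ｝) →
              Conflict P ⊎ (Forced P (r *) × (∀ {s} → s ∈ S → Emulates S s r → EmulatesFor S F s r))
            conflict-extension {r} r∈S conflict with em {P = Degenerate r} | em {P = ｛ r * ｝ ∈ F}
            ... | yes degenerate | _ = inj₁ (conflict-rederive
                    [ inj₁ ∘ axm , (λ { refl → inj₂ degenerate }) ]′ conflict)
            ... | no _ | yes r*∈F = inj₁ (conflict-rederive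
                    [ inj₁ ∘ axm , (λ { refl → inj₁ r-forced }) ]′ conflict)
              where
              r-forced : Forced P r
              r-forced = subst (Forced P) (*-involutive r) (node r*∈F
                (λ { refl → closed r∈S }) refl (λ { refl y≢y → contradiction refl y≢y }))
            ... | no nondegenerate | no r*∉F = ⊎.map₂
                (λ forced → forced , λ s∈S → shifting s∈S r∈S nontrivial nondegenerate r*∉F)
                (conflict⇒forced-* r∈S nontrivial nondegenerate conflict)
              where
              nontrivial : ¬ TrivialIn S r
              nontrivial = r*∉F ∘ standard

            conflict-combine : ∀ {r₁ r₂} → r₁ ∈ S → r₂ ∈ S → r₁ ∉ P → r₂ ∉ P → r₁ ≤ r₂ * →
              Conflict (P ∪ ｛ r₁ ｝) → Conflict (P ∪ ｛ r₂ ｝) → Conflict P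
            conflict-combine {r₁} {r₂} r₁∈S r₂∈S r₁∉P r₂∉P r₁≤r₂* conflict₁ conflict₂
              with conflict-extension r₁∈S conflict₁ | conflict-extension r₂∈S conflict₂
            ... | inj₁ conflict | _             = conflict
            ... | inj₂ _        | inj₁ conflict = conflict
            ... | inj₂ (forced₁* , emulatesFor₁) | inj₂ (forced₂* , emulatesFor₂)
                with em {P = Forced P r₁} | em {P = Forced P r₂}
            ...   | yes forced₁ | _            = cut r₁∉P forced₁ forced₁*
            ...   | no _        | yes forced₂  = cut r₂∉P forced₂ forced₂*
            ...   | no unforced₁ | no unforced₂
                  with s , emulates₁@(s∈S , r₁≤s , _) , emulates₂@(s*∈S , r₂≤s* , _) ←
                    separating xs enumerates submodular r₁∈S r₂∈S r₁≤r₂*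
                  = cut (λ s∈P → r₁∉P (P-down r₁∈S s∈P r₁≤s)) s-forced s*-forced
                where
                -- Shifting by s turns r₁ * into r₁ * ∧ s *, which is s * because r₁ ≤ s; dually,
                -- shifting r₂ * by s * gives s.
                s*-forced : Forced P (s *)
                s*-forced = subst (Forced P) (y≤x⇒x∧y≡y (*-antitone r₁≤s))
                  (shift-forced P-down r₁∉P unforced₁ P⊆S (emulatesFor₁ s∈S emulates₁) forced₁*
                    (≤-reflexive (sym (*-involutive r₁))))
                s-forced : Forced P s
                s-forced = subst (Forced P)
                  (trans (y≤x⇒x∧y≡y (*-antitone r₂≤s*)) (*-involutive s))
                  (shift-forced P-down r₂∉P unforced₂ P⊆S (emulatesFor₂ s*∈S emulates₂) forced₂*
                    (≤-reflexive (sym (*-involutive r₂))))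

          -- Extending partial orientations.

          down-closed-extension : ∀ {P r} → DownClosed P →
            (∀ {z} → z ∈ S ∖ P → z ≤ r → z ≡ r) → DownClosed (P ∪ ｛ r ｝)
          down-closed-extension P-down least z∈S (inj₁ p∈P) z≤p = inj₁ (P-down z∈S p∈P z≤p)
          down-closed-extension {P} P-down least {z} z∈S (inj₂ refl) z≤r with em {P = z ∈ P}
          ... | yes z∈P = inj₁ z∈P
          ... | no z∉P  = inj₂ (sym (least (z∈S , z∉P) z≤r))

          Asymmetric* : Subset → Set c
          Asymmetric* P = ∀ {z} → z ∈ P → z * ∈ P → Degenerate z

          asymmetric-extension : ∀ {P r} → Asymmetric* P → r * ∉ P → Asymmetric* (P ∪ ｛ r ｝)
          asymmetric-extension asym r*∉P (inj₁ z∈P)  (inj₁ z*∈P) = asym z∈P z*∈P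
          asymmetric-extension {P} asym r*∉P (inj₁ z∈P) (inj₂ r≡z*) =
            contradiction (subst (_∈ P) (*-swap (sym r≡z*)) z∈P) r*∉P
          asymmetric-extension asym r*∉P (inj₂ refl) (inj₁ r*∈P) = contradiction r*∈P r*∉P
          asymmetric-extension asym r*∉P (inj₂ refl) (inj₂ r≡r*) = r≡r*

          -- In a violation r ≤ s, down-closure puts r into P as well, so r is degenerate. Then s *
          -- ≤ r ≤ s puts s * into P, so s is degenerate too and equals r.
          down-closed⇒consistent : ∀ {P} → DownClosed P → Asymmetric* P → Consistent S P
          down-closed⇒consistent P-down asym {r} {s} r∈S s∈S distinct r≤s s∈P r*∈P =
            distinct (inj₁ (≤-antisym r≤s (subst (_≤ r) (sym s≡s*) s*≤r)))
            where
            r≡r* : r ≡ r *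
            r≡r* = asym (P-down r∈S s∈P r≤s) r*∈P
            s*≤r : s * ≤ r
            s*≤r = subst (s * ≤_) (sym r≡r*) (*-antitone r≤s)
            s≡s* : s ≡ s *
            s≡s* = asym s∈P (P-down (closed s∈S) s∈P (≤-trans s*≤r r≤s))

          module _ (no-tangle : ¬ ∃ (IsTangle S F)) where

            -- Not being a tangle, P includes some element of F, a conflict all of whose premises
            -- are axioms.
            orientation⇒conflict : ∀ {P} → P ⊆ S → DownClosed P → Asymmetric* P →
              (∀ {z} → z ∈ S → z ∈ P ⊎ z * ∈ P) → Conflict P
            orientation⇒conflict {P} P⊆S P-down asym total = dne {P = Conflict P} λ none → no-tangle
              ( P , (P⊆S , total , asym) , down-closed⇒consistent P-down asym
              , λ {τ} τ⊆P τ∈F → none (τ , τ∈F , P⊆S ∘ τ⊆P , axm ∘ τ⊆P))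

            -- Induction on a bound for a list covering S outside P; adding q to P removes q from
            -- the list.
            conflict : ∀ n ys {P} → length ys ℕ.< n → (∀ {z} → z ∈ S ∖ P → z List.∈ ys) →
                       P ⊆ S → DownClosed P → Asymmetric* P → Conflict P
            conflict (suc n) ys {P} (s≤s ys≤n) remaining P⊆S P-down asym
              with em {P = ∃[ r ] r ∈ S × r ∉ P × r * ∉ P}
            ... | no none = orientation⇒conflict P⊆S P-down asym total
              where
              total : ∀ {z} → z ∈ S → z ∈ P ⊎ z * ∈ P
              total z∈S = dne λ neither →
                none (_ , z∈S , neither ∘ inj₁ , neither ∘ inj₂)
            ... | yes (r , r∈S , r∉P , r*∉P)
                with r₁ , (r₁∈S , r₁∉P) , r₁≤r , least₁ ←
                       minimal-below isPartialOrder {Q = S ∖ P} ys (r∈S , r∉P) (λ z _ _ → remaining z)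
                   | r₂ , (r₂∈S , r₂∉P) , r₂≤r* , least₂ ←
                       minimal-below isPartialOrder {Q = S ∖ P} ys (closed r∈S , r*∉P) (λ z _ _ → remaining z)
                = conflict-combine P⊆S P-down r₁∈S r₂∈S r₁∉P r₂∉P
                    (≤-trans r₁≤r (≤-swapʳ r₂≤r*))
                    -- Like r, the element r₁ is undecided: r₁ * in P would put r * ≤ r₁ * into P.
                    (extend r₁∈S r₁∉P (λ r₁*∈P → r*∉P (P-down (closed r∈S) r₁*∈P (*-antitone r₁≤r))) least₁)
                    (extend r₂∈S r₂∉P (λ r₂*∈P → r∉P (P-down r∈S r₂*∈P (≤-swapʳ r₂≤r*))) least₂)
              where
              extend : ∀ {q} → q ∈ S → q ∉ P → q * ∉ P →
                       (∀ {z} → z ∈ S ∖ P → z ≤ q → z ≡ q) → Conflict (P ∪ ｛ q ｝)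
              extend {q} q∈S q∉P q*∉P least = conflict n (filter (λ _ → em) ys)
                (ℕ.<-≤-trans (filter-notAll {P = _≢ q} (λ _ → em) ys
                   (Any.map (λ { refl z≢z → z≢z refl }) (remaining (q∈S , q∉P)))) ys≤n)
                (λ { (z∈S , z∉P⁺) → ∈-filter⁺ {P = _≢ q} (λ _ → em) (remaining (z∈S , z∉P⁺ ∘ inj₁))
                                    (λ { refl → z∉P⁺ (inj₂ refl) }) })
                [ P⊆S , (λ { refl → q∈S }) ]′
                (down-closed-extension P-down least)
                (asymmetric-extension asym q*∉P)

          -- From derivations to S-trees.

          module _ (respects : F Respects _≐_) where

            -- The root is exempt, as its star is completed only by later grafts.
            Inner : RootedTree → Set f
            Inner T = ∀ t → t ≢ root T → incoming T t ∈ F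

            -- The part of an S-tree behind an edge labelled x that leaves its root; reversed, this
            -- edge adds x * to the star there.
            Branch : Carrier → Set (c ⊔ f)
            Branch x = x ∈ S × ∃[ T ] Inner T × incoming T (root T) ∪ ｛ x * ｝ ∈ F

            assemble : ∀ ys → All Branch ys →
                       ∃[ T ] Inner T × (List._∈ ys) ≐ incoming T (root T)
            assemble [] [] = • , (λ { tt tt≢tt → contradiction refl tt≢tt })
                           , (λ ()) , λ { (_ , () , _) }
            assemble (y ∷ ys) ((y∈S , T′ , inner′ , root∈F) ∷ branches)
              with T , inner , ys⊆ , ⊆ys ← assemble ys branches
              = graft T y∈S T′ , inner″
              , (λ { (here refl) → proj₁ (incoming-root₁ T y∈S T′) (inj₂ refl)
                   ; (there z∈ys) → proj₁ (incoming-root₁ T y∈S T′) (inj₁ (ys⊆ z∈ys)) })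
              , λ z∈ → [ there ∘ ⊆ys , here ∘ sym ]′ (proj₂ (incoming-root₁ T y∈S T′) z∈)
              where
              inner″ : Inner (graft T y∈S T′)
              inner″ (inj₁ t) t≢root = respects (incoming-inj₁ T y∈S T′ t≢root′) (inner t t≢root′)
                where
                t≢root′ : t ≢ root T
                t≢root′ = t≢root ∘ cong inj₁
              inner″ (inj₂ t) _ with em {P = t ≡ root T′}
              ... | yes refl  = respects (incoming-root₂ T y∈S T′) root∈F
              ... | no t≢root = respects (incoming-inj₂ T y∈S T′ t≢root) (inner′ t t≢root)

            -- Since τ lies in S, filtering `xs` lists it. Repetitions in the list only produce
            -- several branches with one label, leaving the set of labels the same.
            assemble-pred : ∀ {τ : Subset} → (∀ {y} → y ∈ τ → Branch y) →
                            ∃[ T ] Inner T × τ ≐ incoming T (root T)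
            assemble-pred {τ} branch
              with T , inner , ys⊆ , ⊆ys ← assemble (filter {P = _∈ τ} (λ _ → em) xs)
                     (All.tabulate λ y∈ys → branch (proj₂ (∈-filter⁻ {P = _∈ τ} (λ _ → em) {xs = xs} y∈ys)))
              = T , inner
              , (λ y∈τ → ys⊆ (∈-filter⁺ {P = _∈ τ} (λ _ → em) (enumerates (proj₁ (branch y∈τ))) y∈τ))
              , λ z∈ → proj₂ (∈-filter⁻ {P = _∈ τ} (λ _ → em) {xs = xs} (⊆ys z∈))

            ∅ : Subset
            ∅ _ = Polymorphic.⊥

            -- Without axioms every leaf is a singleton star in F. The premises become branches at
            -- the root, and the edge labelled x * supplies the missing x.
            forced⇒branch : ∀ {z} → Forced ∅ z → Branch z
            forced⇒branch (node {σ} {x} σ∈F σ⊆S x∈σ rest)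
              with T , inner , σ∖x⊆ , ⊆σ∖x ← assemble-pred {σ ∖ ｛ x ｝}
                     (λ { (y∈σ , x≢y) → forced⇒branch (rest y∈σ (x≢y ∘ sym)) })
              = closed (σ⊆S x∈σ) , T , inner , respects (σ⊆ , ⊆σ) σ∈F
              where
              σ⊆ : σ ⊆ incoming T (root T) ∪ ｛ x * * ｝
              σ⊆ {z} z∈σ with em {P = x ≡ z}
              ... | yes refl = inj₂ (*-involutive x)
              ... | no x≢z   = inj₁ (σ∖x⊆ (z∈σ , x≢z))
              ⊆σ : incoming T (root T) ∪ ｛ x * * ｝ ⊆ σ
              ⊆σ (inj₁ z∈)   = proj₁ (⊆σ∖x z∈)
              ⊆σ (inj₂ refl) = subst (_∈ σ) (sym (*-involutive x)) x∈σ

            conflict⇒sTreeOver : Conflict ∅ → STreeOver S F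
            conflict⇒sTreeOver (σ , σ∈F , σ⊆S , all)
              with T , inner , σ≐ ← assemble-pred (λ y∈σ → forced⇒branch (all y∈σ))
              = sTree T , over
              where
              over : ∀ t → incoming T t ∈ F
              over t with em {P = t ≡ root T}
              ... | yes refl  = respects σ≐ σ∈F
              ... | no t≢root = inner t t≢root

            tangle-or-sTree : ∃ (IsTangle S F) ⊎ STreeOver S F
            tangle-or-sTree with em {P = ∃ (IsTangle S F)}
            ... | yes tangle   = inj₁ tangle
            ... | no no-tangle = inj₂ (conflict⇒sTreeOver
                (conflict no-tangle (suc (length xs)) xs (ℕ.n<1+n _) (enumerates ∘ proj₁)
                  (λ ()) (λ _ ()) (λ ())))

        -- Tangles exclude S-trees.

        -- Directing every edge of the tree as O directs its label, each node has
        -- an outgoing edge, since O does not contain the star at that node.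
        tangle⇒¬sTree : ∃ (IsTangle S F) → ¬ STreeOver S F
        tangle⇒¬sTree (O , (O⊆S , total , asym) , _ , avoids) (𝒯 , over) =
          let v , vs , cycle = nonbacktracking⇒cycle T next em
                (λ v → symmetric (edge v)) nonbacktracking (IsTree.node isTree)
          in IsTree.acyclic isTree v vs cycle
          where
          open STree 𝒯
          outgoing : ∀ t → ∃[ s ] Σ[ e ∈ E s t ] α e ∉ O
          outgoing t = dne λ none → avoids
            (λ { (s , e , refl) → dne λ α∉O → none (s , e , α∉O) }) (over t)
          next : V → V
          next t = proj₁ (outgoing t)
          edge : ∀ t → E (next t) t
          edge t = proj₁ (proj₂ (outgoing t))
          -- Otherwise the edge between t and `next t` is outgoing at both ends, and O contains
          -- neither of its labels.
          nonbacktracking : ∀ t → next (next t) ≢ t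
          nonbacktracking t back = [ proj₂ (proj₂ (outgoing t)) , reversed∉O back (proj₂ (outgoing (next t))) ]′
            (total (α∈S (edge t)))
            where
            reversed∉O : ∀ {s} → s ≡ t → Σ[ e ∈ E s (next t) ] α e ∉ O → α (edge t) * ∉ O
            reversed∉O refl (e , αe∉O) = αe∉O ∘ subst (_∈ O) (sym (α-* (edge t) e))

theorem4 : (∀ {a} → ExcludedMiddle a) →
    {c ℓ f : Level} (U : Universe c ℓ) →
    let open Separations U in
    (S : Subset) → IsSeparationSystem S → IsFinite S → Submodular S →
    (F : Family f) → F Respects _≐_ → (∀ {σ} → σ ∈ F → IsStar σ) →
    Standard S F → ClosedUnderShifting S F →
    ExactlyOneOf (∃ (IsTangle S F)) (STreeOver S F)
theorem4 em U S closed (xs , enumerates) submodular F respects stars standard shifting =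
    tangle-or-sTree em U S closed F stars xs enumerates submodular standard shifting respects
  , λ (tangle , sTree) → tangle⇒¬sTree em U S closed F stars tangle sTree
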